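{- Deciding membership in $\mathsf{CT}^{\mathit{rest}}_{\forall\forall}$, the class of finite rule sets $\Sigma$ such that for every database $D$ every restricted chase sequence of $\langle\Sigma,D\rangle$ is finite, is in $\Pi^1_1$.
   Context: Existential rules are formulas $\forall\vec x,\vec y.\,B\to\exists\vec z.\,H$ ($B,H$ null-free conjunctions of atoms, $H$ non-empty); a database is a finite set of null-free facts. A trigger $\langle R,\sigma\rangle$ ($R\in\Sigma$, $\sigma$ on the universal variables of $R$) is loaded for $F$ if $\sigma(\mathrm{body}(R))\subseteq F$ and obsolete for $F$ if some extension of $\sigma$ to the existential variables maps $\mathrm{head}(R)$ into $F$; its output maps existential variables to fresh nulls. A restricted chase sequence for $\langle\Sigma,D\rangle$ is $F_0=D$, $F_{i+1}=F_i\cup\mathrm{output}(\lambda)$ for some $\Sigma$-trigger $\lambda$ loaded and not obsolete for $F_i$, fair: every trigger loaded for some $F_i$ is obsolete for some $F_j$, $j\ge i$. -}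

module Defs where

open import Data.Nat using (ℕ; _≤_)
open import Data.Bool using (Bool; false)
open import Data.List using (List; map; upTo)
open import Data.List.NonEmpty using (List⁺; toList)
open import Data.List.Membership.Propositional using (_∈_)
open import Data.List.Relation.Binary.Subset.Propositional using (_⊆_)
open import Data.List.Relation.Unary.Any using (Any)
open import Data.List.Relation.Unary.All using (All)
open import Data.Product using (Σ; ∃; _×_)
open import Data.Sum using (_⊎_)
open import Relation.Nullary using (¬_)
open import Relation.Binary.PropositionalEquality using (_≡_)
open import Function.Bundles using (_⇔_)

data RTerm : Set where
  var : ℕ → RTerm
  cst : ℕ → RTerm

data GTerm : Set where
  cst  : ℕ → GTerm
  null : ℕ → GTerm

record Atom (T : Set) : Set where
  constructor atom
  field
    pred : ℕ
    args : List T

Fact : Set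
Fact = Atom GTerm

FactSet : Set
FactSet = List Fact

-- A null-free fact set (a database is a finite null-free fact set).
IsConst : GTerm → Set
IsConst t = ∃ λ c → t ≡ cst c

NullFree : FactSet → Set
NullFree F = All (λ a → All IsConst (Atom.args a)) F

-- An existential rule  ∀x⃗y⃗. B → ∃z⃗. H  with B (possibly empty) and H
-- non-empty conjunctions of null-free atoms.
record Rule : Set where
  constructor rule
  field
    body : List (Atom RTerm)
    head : List⁺ (Atom RTerm)

RuleSet : Set
RuleSet = List Rule

headAtoms : Rule → List (Atom RTerm)
headAtoms r = toList (Rule.head r)

_occursIn_ : ℕ → List (Atom RTerm) → Set
x occursIn As = Any (λ a → var x ∈ Atom.args a) As

Universal : Rule → ℕ → Set
Universal r x = x occursIn Rule.body r

Existential : Rule → ℕ → Set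
Existential r x = (x occursIn headAtoms r) × ¬ Universal r x

-- Substitutions (only their values on the relevant variables matter).

Subst : Set
Subst = ℕ → GTerm

applyT : Subst → RTerm → GTerm
applyT σ (var x) = σ x
applyT σ (cst c) = cst c

applyA : Subst → Atom RTerm → Fact
applyA σ (atom p ts) = atom p (map (applyT σ) ts)

applyL : Subst → List (Atom RTerm) → FactSet
applyL σ = map (applyA σ)

-- Trigger ⟨R, σ⟩ (σ relevant on the universal variables of R).
Loaded : Rule → Subst → FactSet → Set
Loaded r σ F = applyL σ (Rule.body r) ⊆ F

Obsolete : Rule → Subst → FactSet → Set
Obsolete r σ F =
  ∃ λ τ → (∀ x → Universal r x → τ x ≡ σ x) × (applyL τ (headAtoms r) ⊆ F)

NullOccurs : ℕ → FactSet → Set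
NullOccurs n F = Any (λ a → null n ∈ Atom.args a) F

RChaseStep : RuleSet → FactSet → FactSet → Set
RChaseStep Σs F F' =
  ∃ λ r → ∃ λ σ → ∃ λ (ν : ℕ → ℕ) →
    (r ∈ Σs) × Loaded r σ F × ¬ Obsolete r σ F
    × (∀ x → Existential r x → σ x ≡ null (ν x))
    × (∀ x y → Existential r x → Existential r y → ν x ≡ ν y → x ≡ y)
    × (∀ x → Existential r x → ¬ NullOccurs (ν x) F)
    × (∀ a → (a ∈ F') ⇔ ((a ∈ F) ⊎ (a ∈ applyL σ (headAtoms r))))

record InfiniteRChase (Σs : RuleSet) (D : FactSet) : Set where
  field
    F     : ℕ → FactSet
    start : ∀ a → (a ∈ F 0) ⇔ (a ∈ D)
    step  : ∀ i → RChaseStep Σs (F i) (F (Data.Nat.suc i))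
    fair  : ∀ i r σ → r ∈ Σs → Loaded r σ (F i) →
            ∃ λ j → (i ≤ j) × Obsolete r σ (F j)

CTrest∀∀ : RuleSet → Set
CTrest∀∀ Σs = ∀ D → NullFree D → ¬ InfiniteRChase Σs D

-- Π¹₁ (Kleene normal form): P a ⇔ ∀ f : ℕ → ℕ. ∃ n. R(a, f↾n), with R
-- computable (a total Agda function, constructed in a --safe proof).
-- The inner "∀ f ∃ n" is stated in the classically equivalent form
-- "∀ f. ¬ ∀ n. ¬ R(a, f↾n)".

prefix : (ℕ → ℕ) → ℕ → List ℕ
prefix f n = map f (upTo n)

IsΠ¹₁ : {A : Set} → (A → Set) → Set
IsΠ¹₁ {A} P =
  Σ (A → List ℕ → Bool) λ R →
    ∀ a → P a ⇔ (∀ (f : ℕ → ℕ) → ¬ (∀ n → R a (prefix f n) ≡ false))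

{-# OPTIONS --safe #-}
-- Σ fails to be in CT^rest_∀∀ iff some stream f : ℕ → ℕ encodes an infinite fair restricted chase:
-- f 0 codes the database and f (k + 1) the k-th step, i.e. the applied trigger together with a
-- deadline by which every trigger loaded before the step is obsolete.  Recording deadlines turns
-- fairness, a ∀∃ condition on the sequence, into a condition on f that can be checked on finite
-- prefixes; one deadline per step suffices, as only finitely many triggers are loaded at a time
-- (up to their values on the body variables) and obsolescence persists as the fact set grows.
-- Checking a prefix is decidable, because loadedness, obsolescence and freshness only involve the
-- finitely many terms of the current fact set.  So Σ ∈ CT^rest_∀∀ iff every f has a rejected prefix.
module Submission where

open import Defs
open import Data.Bool using (Bool; false; not)
open import Data.Empty using (⊥; ⊥-elim)
open import Data.List
  using (List; []; _∷_; _++_; length; applyUpTo; map; concatMap; filter; cartesianProductWith)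
open import Data.List.Membership.Propositional using (_∈_; find; lose)
open import Data.List.Membership.Propositional.Properties
  using ( ∈-map⁺; ∈-++⁺ˡ; ∈-++⁺ʳ; ∈-++⁻; ∈-concatMap⁺; ∈-concatMap⁻; ∈-filter⁺; ∈-filter⁻
        ; ∈-cartesianProductWith⁺ )
open import Data.List.NonEmpty using (List⁺; _∷_)
open import Data.List.Properties
  using (map-∘; map-cong; map-id; map-cong-local; map-upTo; length-applyUpTo)
import Data.List.Relation.Binary.Subset.DecPropositional as SubsetDec
open import Data.List.Relation.Binary.Subset.Propositional using (_⊆_)
open import Data.List.Relation.Binary.Subset.Propositional.Properties using (Any-resp-⊆)
open import Data.List.Relation.Unary.All using (All; []; _∷_; all?)
import Data.List.Relation.Unary.All as All
open import Data.List.Relation.Unary.Any using (Any; here; there; any?)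
import Data.List.Relation.Unary.Any as Any
open import Data.Nat
  using (ℕ; zero; suc; _+_; _≤_; _<_; _<?_; _⊔_; z≤n; s≤s; _≤′_; ≤′-refl; ≤′-step)
  renaming (_≟_ to _≟ℕ_)
open import Data.List.Membership.DecPropositional _≟ℕ_ using (_∈?_)
open import Data.Nat.Binary using (ℕᵇ; 2[1+_]; 1+[2_]; toℕ; fromℕ) renaming (zero to zeroᵇ)
open import Data.Nat.Binary.Properties using (fromℕ-toℕ)
open import Data.Nat.Properties
  using ( eq?; allUpTo?; ≤-refl; ≤-<-trans; <⇒≤; ≤⇒≤′; m<n⇒m<1+n; m≤m⊔n; m≤n⊔m; m≤m+n
        ; m≤n+m )
open import Data.Product using (∃; _×_; _,_; proj₁; proj₂; uncurry)
open import Data.Sum using (_⊎_; inj₁; inj₂; [_,_]; [_,_]′)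
import Data.Sum as Sum
open import Function using (_∘_; id)
open import Function.Bundles using (_⇔_; mk⇔; mk↣; Equivalence)
open import Relation.Binary.Definitions using (DecidableEquality)
open import Relation.Binary.PropositionalEquality
  using (_≡_; refl; sym; trans; cong; cong₂; subst; subst₂; module ≡-Reasoning)
open import Relation.Nullary using (¬_; Dec; yes; no; does)
open import Relation.Nullary.Decidable using (map′; ¬?; _×-dec_; _→-dec_)

open Equivalence using (to; from)

record Coding (A : Set) : Set where
  field
    encode        : A → ℕ
    decode        : ℕ → A
    decode-encode : ∀ a → decode (encode a) ≡ a

  encode-injective : ∀ {a b} → encode a ≡ encode b → a ≡ b
  encode-injective {a} {b} e = begin
    a                 ≡⟨ sym (decode-encode a) ⟩
    decode (encode a) ≡⟨ cong decode e ⟩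
    decode (encode b) ≡⟨ decode-encode b ⟩
    b                 ∎
    where open ≡-Reasoning

  _≟_ : DecidableEquality A
  _≟_ = eq? (mk↣ encode-injective)

open Coding

-- In bijective binary, least significant digit first, a ∷ l is written as a 2s, then a 1, then the word of l.
prependᵇ : ℕ → ℕᵇ → ℕᵇ
prependᵇ zero    w = 1+[2 w ]
prependᵇ (suc a) w = 2[1+ prependᵇ a w ]

encodeᵇ : List ℕ → ℕᵇ
encodeᵇ []      = zeroᵇ
encodeᵇ (a ∷ l) = prependᵇ a (encodeᵇ l)

incrementHead : List ℕ → List ℕ
incrementHead []      = []
incrementHead (a ∷ l) = suc a ∷ l

decodeᵇ : ℕᵇ → List ℕ
decodeᵇ zeroᵇ     = []
decodeᵇ 1+[2 w ]  = 0 ∷ decodeᵇ w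
decodeᵇ 2[1+ w ]  = incrementHead (decodeᵇ w)

decodeᵇ-prependᵇ : ∀ a w → decodeᵇ (prependᵇ a w) ≡ a ∷ decodeᵇ w
decodeᵇ-prependᵇ zero    w = refl
decodeᵇ-prependᵇ (suc a) w = cong incrementHead (decodeᵇ-prependᵇ a w)

decodeᵇ-encodeᵇ : ∀ l → decodeᵇ (encodeᵇ l) ≡ l
decodeᵇ-encodeᵇ []      = refl
decodeᵇ-encodeᵇ (a ∷ l) =
  trans (decodeᵇ-prependᵇ a (encodeᵇ l)) (cong (a ∷_) (decodeᵇ-encodeᵇ l))

ℕ-coding : Coding ℕ
ℕ-coding = record { encode = id ; decode = id ; decode-encode = λ _ → refl }

Listℕ-coding : Coding (List ℕ)
Listℕ-coding = record
  { encode        = toℕ ∘ encodeᵇ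
  ; decode        = decodeᵇ ∘ fromℕ
  ; decode-encode = λ l → trans (cong decodeᵇ (fromℕ-toℕ (encodeᵇ l))) (decodeᵇ-encodeᵇ l)
  }

retract : {A B : Set} → Coding B →
          (to : A → B) (from : B → A) → (∀ a → from (to a) ≡ a) → Coding A
retract C to from from-to = record
  { encode        = encode C ∘ to
  ; decode        = from ∘ decode C
  ; decode-encode = λ a → trans (cong from (decode-encode C (to a))) (from-to a)
  }

List-coding : {A : Set} → Coding A → Coding (List A)
List-coding C = retract Listℕ-coding (map (encode C)) (map (decode C)) λ l → begin
  map (decode C) (map (encode C) l) ≡⟨ sym (map-∘ l) ⟩
  map (decode C ∘ encode C) l       ≡⟨ map-cong (decode-encode C) l ⟩
  map id l                          ≡⟨ map-id l ⟩
  l                                 ∎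
  where open ≡-Reasoning

×-coding : {A B : Set} → Coding A → Coding B → Coding (A × B)
×-coding {A} {B} CA CB = retract Listℕ-coding (λ (a , b) → encode CA a ∷ encode CB b ∷ []) pair
  λ (a , b) → cong₂ _,_ (decode-encode CA a) (decode-encode CB b)
  where
  pair : List ℕ → A × B
  pair (m ∷ n ∷ _) = decode CA m , decode CB n
  pair _           = decode CA 0 , decode CB 0

⊎-coding : {A B : Set} → Coding A → Coding B → Coding (A ⊎ B)
⊎-coding {A} {B} CA CB = retract (×-coding ℕ-coding ℕ-coding) tag untag
  [ (λ a → cong inj₁ (decode-encode CA a)) , (λ b → cong inj₂ (decode-encode CB b)) ]
  where
  tag : A ⊎ B → ℕ × ℕ
  tag (inj₁ a) = 0 , encode CA a
  tag (inj₂ b) = 1 , encode CB b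
  untag : ℕ × ℕ → A ⊎ B
  untag (zero  , n) = inj₁ (decode CA n)
  untag (suc _ , n) = inj₂ (decode CB n)

GTerm-coding : Coding GTerm
GTerm-coding = retract (⊎-coding ℕ-coding ℕ-coding) toSum [ cst , null ]
  λ { (cst _) → refl ; (null _) → refl }
  where
  toSum : GTerm → ℕ ⊎ ℕ
  toSum (cst c)  = inj₁ c
  toSum (null n) = inj₂ n

RTerm-coding : Coding RTerm
RTerm-coding = retract (⊎-coding ℕ-coding ℕ-coding) toSum [ var , cst ]
  λ { (var _) → refl ; (cst _) → refl }
  where
  toSum : RTerm → ℕ ⊎ ℕ
  toSum (var x) = inj₁ x
  toSum (cst c) = inj₂ c

Atom-coding : {T : Set} → Coding T → Coding (Atom T)
Atom-coding C = retract (×-coding ℕ-coding (List-coding C))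
  (λ a → Atom.pred a , Atom.args a) (uncurry atom) λ _ → refl

List⁺-coding : {A : Set} → Coding A → Coding (List⁺ A)
List⁺-coding C = retract (×-coding C (List-coding C))
  (λ (x ∷ xs) → x , xs) (uncurry _∷_) λ _ → refl

Rule-coding : Coding Rule
Rule-coding = retract (×-coding (List-coding atomCoding) (List⁺-coding atomCoding))
  (λ r → Rule.body r , Rule.head r) (uncurry rule) λ _ → refl
  where
  atomCoding : Coding (Atom RTerm)
  atomCoding = Atom-coding RTerm-coding

Fact-coding : Coding Fact
Fact-coding = Atom-coding GTerm-coding

open SubsetDec (_≟_ Fact-coding) using (_⊆?_)

varsT : List RTerm → List ℕ
varsT []           = []
varsT (var x ∷ ts) = x ∷ varsT ts
varsT (cst _ ∷ ts) = varsT ts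

∈-varsT⁺ : ∀ {x} ts → var x ∈ ts → x ∈ varsT ts
∈-varsT⁺ (var _ ∷ ts) (here refl) = here refl
∈-varsT⁺ (var _ ∷ ts) (there p)   = there (∈-varsT⁺ ts p)
∈-varsT⁺ (cst _ ∷ ts) (there p)   = ∈-varsT⁺ ts p

∈-varsT⁻ : ∀ {x} ts → x ∈ varsT ts → var x ∈ ts
∈-varsT⁻ (var _ ∷ ts) (here refl) = here refl
∈-varsT⁻ (var _ ∷ ts) (there p)   = there (∈-varsT⁻ ts p)
∈-varsT⁻ (cst _ ∷ ts) p           = there (∈-varsT⁻ ts p)

vars : List (Atom RTerm) → List ℕ
vars = concatMap (varsT ∘ Atom.args)

occurs⇒∈vars : ∀ {x As} → x occursIn As → x ∈ vars As
occurs⇒∈vars = ∈-concatMap⁺ _ ∘ Any.map (∈-varsT⁺ _)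

∈vars⇒occurs : ∀ {x} As → x ∈ vars As → x occursIn As
∈vars⇒occurs As = Any.map (∈-varsT⁻ _) ∘ ∈-concatMap⁻ _ {As}

bodyVars headVars ruleVars existentials : Rule → List ℕ
bodyVars r     = vars (Rule.body r)
headVars r     = vars (headAtoms r)
ruleVars r     = bodyVars r ++ headVars r
existentials r = filter (λ x → ¬? (x ∈? bodyVars r)) (headVars r)

existential⇒∈ : ∀ {r x} → Existential r x → x ∈ existentials r
existential⇒∈ (occ , ¬univ) = ∈-filter⁺ _ (occurs⇒∈vars occ) (¬univ ∘ ∈vars⇒occurs _)

∈⇒existential : ∀ {r x} → x ∈ existentials r → Existential r x
∈⇒existential {r} x∈ with ∈-filter⁻ _ {xs = headVars r} x∈
... | x∈head , x∉body = ∈vars⇒occurs _ x∈head , x∉body ∘ occurs⇒∈vars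

_≗[_]_ : Subst → List ℕ → Subst → Set
σ ≗[ vs ] τ = ∀ {x} → x ∈ vs → σ x ≡ τ x

applyL-cong : ∀ {σ τ} As → σ ≗[ vars As ] τ → applyL σ As ≡ applyL τ As
applyL-cong {σ} {τ} As σ≗τ =
  map-cong-local (All.tabulate λ a∈As →
    cong (atom _) (map-cong-local (All.tabulate (agree a∈As))))
  where
  agree : ∀ {a t} → a ∈ As → t ∈ Atom.args a → applyT σ t ≡ applyT τ t
  agree {t = var x} a∈As t∈a = σ≗τ (occurs⇒∈vars (lose a∈As t∈a))
  agree {t = cst c} _    _   = refl

termsOf : FactSet → List GTerm
termsOf = concatMap Atom.args

value∈termsOf : ∀ {σ x F} As → applyL σ As ⊆ F → x occursIn As → σ x ∈ termsOf F
value∈termsOf {σ} As As⊆F occ with find occ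
... | a , a∈As , x∈a =
  ∈-concatMap⁺ Atom.args (lose (As⊆F (∈-map⁺ (applyA σ) a∈As)) (∈-map⁺ (applyT σ) x∈a))

-- Positional: the first occurrence of a variable wins, and unassigned variables go to cst 0.
assign : List ℕ → List GTerm → Subst
assign (v ∷ vs) (t ∷ ts) x with x ≟ℕ v
... | yes _ = t
... | no  _ = assign vs ts x
assign _ _ _ = cst 0

assign-map : ∀ {σ} vs → assign vs (map σ vs) ≗[ vs ] σ
assign-map (v ∷ vs) {x} x∈ with x ≟ℕ v | x∈
... | yes refl | _          = refl
... | no  x≢v  | here x≡v   = ⊥-elim (x≢v x≡v)
... | no  _    | there x∈vs = assign-map vs x∈vs

assignments : List ℕ → List GTerm → List (List GTerm)
assignments []       T = [] ∷ []
assignments (_ ∷ vs) T = cartesianProductWith _∷_ T (assignments vs T)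

map∈assignments : ∀ {σ T} vs → (∀ {x} → x ∈ vs → σ x ∈ T) → map σ vs ∈ assignments vs T
map∈assignments []       _   = here refl
map∈assignments (v ∷ vs) σ∈T =
  ∈-cartesianProductWith⁺ _∷_ (σ∈T (here refl)) (map∈assignments vs (σ∈T ∘ there))

override : List ℕ → Subst → Subst → Subst
override vs σ τ x with x ∈? vs
... | yes _ = σ x
... | no  _ = τ x

override-∈ : ∀ {vs σ τ x} → x ∈ vs → override vs σ τ x ≡ σ x
override-∈ {vs} {x = x} x∈ with x ∈? vs
... | yes _  = refl
... | no x∉ = ⊥-elim (x∉ x∈)

Loaded-cong : ∀ {r σ τ F} → σ ≗[ bodyVars r ] τ → Loaded r σ F → Loaded r τ F
Loaded-cong {r} {F = F} σ≗τ = subst (_⊆ F) (applyL-cong (Rule.body r) σ≗τ)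

Obsolete-cong : ∀ {r σ τ F} → σ ≗[ bodyVars r ] τ → Obsolete r σ F → Obsolete r τ F
Obsolete-cong σ≗τ (ρ , ρ≗σ , head⊆F) =
  ρ , (λ x u → trans (ρ≗σ x u) (σ≗τ (occurs⇒∈vars u))) , head⊆F

Obsolete-mono : ∀ {r σ F G} → F ⊆ G → Obsolete r σ F → Obsolete r σ G
Obsolete-mono F⊆G (ρ , ρ≗σ , head⊆F) = ρ , ρ≗σ , F⊆G ∘ head⊆F

loaded? : ∀ r σ F → Dec (Loaded r σ F)
loaded? r σ F = applyL σ (Rule.body r) ⊆? F

-- Only the values of a witness on the head variables matter, and those are terms of F.
module _ (r : Rule) (σ : Subst) (F : FactSet) where

  extension : List GTerm → Subst
  extension ts = override (bodyVars r) σ (assign (headVars r) ts)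

  Witness : List GTerm → Set
  Witness ts = applyL (extension ts) (headAtoms r) ⊆ F

  obsolete⇒witness : Obsolete r σ F → Any Witness (assignments (headVars r) (termsOf F))
  obsolete⇒witness (ρ , ρ≗σ , head⊆F) =
    lose (map∈assignments (headVars r) (value∈termsOf (headAtoms r) head⊆F ∘ ∈vars⇒occurs _))
         (subst (_⊆ F) (sym (applyL-cong (headAtoms r) extension≗ρ)) head⊆F)
    where
    extension≗ρ : extension (map ρ (headVars r)) ≗[ headVars r ] ρ
    extension≗ρ {x} x∈head with x ∈? bodyVars r
    ... | yes x∈body = sym (ρ≗σ x (∈vars⇒occurs _ x∈body))
    ... | no  _      = assign-map (headVars r) x∈head

  witness⇒obsolete : Any Witness (assignments (headVars r) (termsOf F)) → Obsolete r σ F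
  witness⇒obsolete w with find w
  ... | ts , _ , head⊆F = extension ts , (λ x u → override-∈ (occurs⇒∈vars u)) , head⊆F

obsolete? : ∀ r σ F → Dec (Obsolete r σ F)
obsolete? r σ F =
  map′ (witness⇒obsolete r σ F) (obsolete⇒witness r σ F)
       (any? (λ ts → _ ⊆? F) (assignments (headVars r) (termsOf F)))

FreshNull : FactSet → GTerm → Set
FreshNull F (cst _)  = ⊥
FreshNull F (null n) = ¬ NullOccurs n F

freshNull? : ∀ F t → Dec (FreshNull F t)
freshNull? F (cst _)  = no id
freshNull? F (null n) = ¬? (any? (λ a → any? (_≟_ GTerm-coding (null n)) (Atom.args a)) F)

-- Only meaningful on nulls: it is used for existential variables, whose values must be FreshNull.
nullIndex : GTerm → ℕ
nullIndex (cst _)  = 0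
nullIndex (null n) = n

FreshNull⇒ : ∀ {F} t → FreshNull F t → t ≡ null (nullIndex t) × ¬ NullOccurs (nullIndex t) F
FreshNull⇒ (null n) fresh = refl , fresh

FreshNull-anti : ∀ {F G} → G ⊆ F → ∀ {t} → FreshNull F t → FreshNull G t
FreshNull-anti G⊆F {null n} fresh = fresh ∘ Any-resp-⊆ G⊆F

Applicable : RuleSet → Rule → Subst → FactSet → Set
Applicable Σs r σ F =
  r ∈ Σs × Loaded r σ F × ¬ Obsolete r σ F
  × All (FreshNull F ∘ σ) (existentials r)
  × All (λ x → All (λ y → nullIndex (σ x) ≡ nullIndex (σ y) → x ≡ y) (existentials r)) (existentials r)

applicable? : ∀ Σs r σ F → Dec (Applicable Σs r σ F)
applicable? Σs r σ F =
  any? (_≟_ Rule-coding r) Σs ×-dec loaded? r σ F ×-dec ¬? (obsolete? r σ F)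
  ×-dec all? (freshNull? F ∘ σ) (existentials r)
  ×-dec all? (λ x → all? (λ y → nullIndex (σ x) ≟ℕ nullIndex (σ y) →-dec x ≟ℕ y) _) _

Applicable⇒RChaseStep : ∀ {Σs r σ F} → Applicable Σs r σ F →
                        RChaseStep Σs F (F ++ applyL σ (headAtoms r))
Applicable⇒RChaseStep {r = r} {σ} {F} (r∈Σs , loaded , ¬obsolete , fresh , injective) =
  r , σ , nullIndex ∘ σ , r∈Σs , loaded , ¬obsolete
  , (λ x ex → proj₁ (fresh-at ex))
  , (λ x y ex ey → All.lookup (All.lookup injective (existential⇒∈ ex)) (existential⇒∈ ey))
  , (λ x ex → proj₂ (fresh-at ex))
  , λ a → mk⇔ (∈-++⁻ F) [ ∈-++⁺ˡ , ∈-++⁺ʳ F ]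
  where
  fresh-at : ∀ {x} → Existential r x →
             σ x ≡ null (nullIndex (σ x)) × ¬ NullOccurs (nullIndex (σ x)) F
  fresh-at ex = FreshNull⇒ _ (All.lookup fresh (existential⇒∈ ex))

appliedRule : ∀ {Σs F F′} → RChaseStep Σs F F′ → Rule
appliedRule = proj₁

appliedSubst : ∀ {Σs F F′} → RChaseStep Σs F F′ → Subst
appliedSubst = proj₁ ∘ proj₂

output⇔ : ∀ {Σs F F′} (st : RChaseStep Σs F F′) a →
          a ∈ F′ ⇔ (a ∈ F ⊎ a ∈ applyL (appliedSubst st) (headAtoms (appliedRule st)))
output⇔ (_ , _ , _ , _ , _ , _ , _ , _ , _ , out) = out

RChaseStep⇒Applicable : ∀ {Σs F F′} (st : RChaseStep Σs F F′) →
                        Applicable Σs (appliedRule st) (appliedSubst st) F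
RChaseStep⇒Applicable {F = F} (r , σ , ν , r∈Σs , loaded , ¬obsolete , σ≡ν , ν-injective , ν-fresh , _) =
  r∈Σs , loaded , ¬obsolete , All.tabulate fresh , All.tabulate λ x∈ → All.tabulate (injective x∈)
  where
  fresh : ∀ {x} → x ∈ existentials r → FreshNull F (σ x)
  fresh {x} x∈ rewrite σ≡ν x (∈⇒existential x∈) = ν-fresh x (∈⇒existential x∈)
  injective : ∀ {x y} → x ∈ existentials r → y ∈ existentials r →
              nullIndex (σ x) ≡ nullIndex (σ y) → x ≡ y
  injective {x} {y} x∈ y∈ rewrite σ≡ν x (∈⇒existential x∈) | σ≡ν y (∈⇒existential y∈) =
    ν-injective x y (∈⇒existential x∈) (∈⇒existential y∈)

Applicable-cong : ∀ {Σs r σ τ F} → σ ≗[ ruleVars r ] τ →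
                  Applicable Σs r σ F → Applicable Σs r τ F
Applicable-cong {r = r} {σ} {τ} {F} σ≗τ (r∈Σs , loaded , ¬obsolete , fresh , injective) =
  r∈Σs , Loaded-cong {r} on-body loaded , ¬obsolete ∘ Obsolete-cong {r} (sym ∘ on-body)
  , All.tabulate (λ x∈ → subst (FreshNull F) (on-existentials x∈) (All.lookup fresh x∈))
  , All.tabulate λ x∈ → All.tabulate λ y∈ τx≡τy → All.lookup (All.lookup injective x∈) y∈
      (trans (cong nullIndex (on-existentials x∈))
             (trans τx≡τy (sym (cong nullIndex (on-existentials y∈)))))
  where
  on-body : σ ≗[ bodyVars r ] τ
  on-body = σ≗τ ∘ ∈-++⁺ˡ
  on-existentials : σ ≗[ existentials r ] τ
  on-existentials x∈ = σ≗τ (∈-++⁺ʳ (bodyVars r) (proj₁ (∈-filter⁻ _ {xs = headVars r} x∈)))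

Applicable-resp : ∀ {Σs r σ F G} → F ⊆ G → G ⊆ F →
                  Applicable Σs r σ F → Applicable Σs r σ G
Applicable-resp F⊆G G⊆F (r∈Σs , loaded , ¬obsolete , fresh , injective) =
  r∈Σs , F⊆G ∘ loaded , ¬obsolete ∘ Obsolete-mono G⊆F
  , All.map (FreshNull-anti G⊆F) fresh , injective

LoadedObsolete : FactSet → FactSet → Rule → Subst → Set
LoadedObsolete F G r σ = Loaded r σ F → Obsolete r σ G

-- Up to agreement on the body variables, the triggers loaded for F are among those enumerated here.
AllLoadedObsolete : RuleSet → FactSet → FactSet → Set
AllLoadedObsolete Σs F G =
  All (λ r → All (LoadedObsolete F G r ∘ assign (bodyVars r)) (assignments (bodyVars r) (termsOf F)))
      Σs

allLoadedObsolete? : ∀ Σs F G → Dec (AllLoadedObsolete Σs F G)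
allLoadedObsolete? Σs F G =
  all? (λ r → all? (λ ts → let σ = assign (bodyVars r) ts in loaded? r σ F →-dec obsolete? r σ G)
                   (assignments (bodyVars r) (termsOf F)))
       Σs

AllLoadedObsolete-lookup : ∀ {Σs F G r σ} → AllLoadedObsolete Σs F G →
                           r ∈ Σs → Loaded r σ F → Obsolete r σ G
AllLoadedObsolete-lookup {F = F} {r = r} {σ} all r∈Σs loaded =
  Obsolete-cong {r} (assign-map (bodyVars r))
    (All.lookup (All.lookup all r∈Σs) (map∈assignments (bodyVars r) values∈terms)
      (Loaded-cong {r} (sym ∘ assign-map (bodyVars r)) loaded))
  where
  values∈terms : ∀ {x} → x ∈ bodyVars r → σ x ∈ termsOf F
  values∈terms = value∈termsOf (Rule.body r) loaded ∘ ∈vars⇒occurs _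

accumulate : FactSet → (ℕ → FactSet) → ℕ → FactSet
accumulate D out zero    = D
accumulate D out (suc k) = accumulate D out k ++ out k

accumulate-mono : ∀ {D out i j} → i ≤ j → accumulate D out i ⊆ accumulate D out j
accumulate-mono = go ∘ ≤⇒≤′
  where
  go : ∀ {D out i j} → i ≤′ j → accumulate D out i ⊆ accumulate D out j
  go ≤′-refl       = id
  go (≤′-step i≤j) = ∈-++⁺ˡ ∘ go i≤j

accumulate-cong : ∀ {D D′ out out′} k → D ≡ D′ → (∀ {i} → i < k → out i ≡ out′ i) →
                  accumulate D out k ≡ accumulate D′ out′ k
accumulate-cong zero    D≡D′ out≡ = D≡D′
accumulate-cong (suc k) D≡D′ out≡ =
  cong₂ _++_ (accumulate-cong k D≡D′ (out≡ ∘ m<n⇒m<1+n)) (out≡ ≤-refl)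

uniform-bound : {A : Set} (P : A → ℕ → Set) → (∀ {a i j} → i ≤ j → P a i → P a j) →
                ∀ {xs} → All (λ a → ∃ (P a)) xs → ∃ λ j → All (λ a → P a j) xs
uniform-bound P mono []             = 0 , []
uniform-bound P mono ((i , p) ∷ ps) with uniform-bound P mono ps
... | j , qs = i ⊔ j , mono (m≤m⊔n i j) p ∷ All.map (mono (m≤n⊔m i j)) qs

record Step : Set where
  constructor mkStep
  field
    stepRule : Rule
    values   : List GTerm
    deadline : ℕ

open Step

Step-coding : Coding Step
Step-coding = retract (×-coding Rule-coding (×-coding (List-coding GTerm-coding) ℕ-coding))
  (λ s → stepRule s , values s , deadline s) (λ (r , ts , j) → mkStep r ts j) λ _ → refl

FactSet-coding : Coding FactSet
FactSet-coding = List-coding Fact-coding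

stepSubst : Step → Subst
stepSubst s = assign (ruleVars (stepRule s)) (values s)

output : Step → FactSet
output s = applyL (stepSubst s) (headAtoms (stepRule s))

database : (ℕ → ℕ) → FactSet
database f = decode FactSet-coding (f 0)

stepAt : (ℕ → ℕ) → ℕ → Step
stepAt f k = decode Step-coding (f (suc k))

chaseOf : (ℕ → ℕ) → ℕ → FactSet
chaseOf f = accumulate (database f) (output ∘ stepAt f)

-- Deadlines at or beyond the inspected length n are not checked yet.
StepCheck : RuleSet → ℕ → FactSet → Step → (ℕ → FactSet) → Set
StepCheck Σs n F s later =
  Applicable Σs (stepRule s) (stepSubst s) F
  × (deadline s < n → AllLoadedObsolete Σs F (later (deadline s)))

stepCheck? : ∀ Σs n F s later → Dec (StepCheck Σs n F s later)
stepCheck? Σs n F s later =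
  applicable? Σs (stepRule s) (stepSubst s) F
  ×-dec (deadline s <? n →-dec allLoadedObsolete? Σs F (later (deadline s)))

Check : RuleSet → (ℕ → ℕ) → ℕ → ℕ → Set
Check Σs f n zero    = NullFree (database f)
Check Σs f n (suc k) = StepCheck Σs n (chaseOf f k) (stepAt f k) (chaseOf f)

check? : ∀ Σs f n i → Dec (Check Σs f n i)
check? Σs f n zero    = all? (λ a → all? isConst? (Atom.args a)) (database f)
  where
  isConst? : ∀ t → Dec (IsConst t)
  isConst? (cst c)  = yes (c , refl)
  isConst? (null _) = no λ ()
check? Σs f n (suc k) = stepCheck? Σs n (chaseOf f k) (stepAt f k) (chaseOf f)

Accepts : RuleSet → (ℕ → ℕ) → ℕ → Set
Accepts Σs f n = ∀ {i} → i < n → Check Σs f n i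

accepts? : ∀ Σs f n → Dec (Accepts Σs f n)
accepts? Σs f n = allUpTo? (check? Σs f n) n

-- Reading a list as a stream, padded with zeros.
_!_ : List ℕ → ℕ → ℕ
[]      ! _     = 0
(x ∷ _) ! zero  = x
(_ ∷ l) ! suc i = l ! i

Rejects : RuleSet → List ℕ → Bool
Rejects Σs l = not (does (accepts? Σs (l !_) (length l)))

chaseOf-local : ∀ {f g} k → (∀ {i} → i ≤ k → f i ≡ g i) → chaseOf f k ≡ chaseOf g k
chaseOf-local k f≡g =
  accumulate-cong k (cong (decode FactSet-coding) (f≡g z≤n)) (cong (output ∘ decode Step-coding) ∘ f≡g)

StepCheck-later : ∀ {Σs n F s later later′} → (∀ {j} → j < n → later j ≡ later′ j) →
                  StepCheck Σs n F s later → StepCheck Σs n F s later′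
StepCheck-later later≡ (applicable , met) =
  applicable , λ j<n → subst (AllLoadedObsolete _ _) (later≡ j<n) (met j<n)

Accepts-local : ∀ {Σs f g n} → (∀ {i} → i < n → f i ≡ g i) → Accepts Σs f n → Accepts Σs g n
Accepts-local f≡g accepts {zero} 0<n =
  subst NullFree (cong (decode FactSet-coding) (f≡g 0<n)) (accepts 0<n)
Accepts-local {Σs} {f} {n = n} f≡g accepts {suc k} k<n =
  StepCheck-later (λ j<n → chaseOf-local _ (f≡g ∘ λ i≤j → ≤-<-trans i≤j j<n))
    (subst₂ (λ F s → StepCheck Σs n F s (chaseOf f))
      (chaseOf-local k (f≡g ∘ λ i≤k → ≤-<-trans i≤k (<⇒≤ k<n)))
      (cong (decode Step-coding) (f≡g k<n))
      (accepts k<n))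

applyUpTo-! : ∀ f {n i} → i < n → applyUpTo f n ! i ≡ f i
applyUpTo-! f {suc n} {zero}  _         = refl
applyUpTo-! f {suc n} {suc i} (s≤s i<n) = applyUpTo-! (f ∘ suc) i<n

not-does≡false⇔ : ∀ {P : Set} (P? : Dec P) → not (does P?) ≡ false ⇔ P
not-does≡false⇔ (yes p) = mk⇔ (λ _ → p) (λ _ → refl)
not-does≡false⇔ (no ¬p) = mk⇔ (λ ()) (⊥-elim ∘ ¬p)

Rejects-prefix : ∀ Σs f n → Rejects Σs (prefix f n) ≡ false ⇔ Accepts Σs f n
Rejects-prefix Σs f n rewrite map-upTo f n =
  mk⇔ (Accepts-local (applyUpTo-! f) ∘ subst (Accepts Σs (l !_)) length≡ ∘ to decision)
      (from decision ∘ subst (Accepts Σs (l !_)) (sym length≡)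
                     ∘ Accepts-local (sym ∘ applyUpTo-! f))
  where
  l : List ℕ
  l = applyUpTo f n
  length≡ : length l ≡ n
  length≡ = length-applyUpTo f n
  decision : not (does (accepts? Σs (l !_) (length l))) ≡ false ⇔ Accepts Σs (l !_) (length l)
  decision = not-does≡false⇔ (accepts? Σs (l !_) (length l))

module _ {Σs f} (accepted : ∀ n → Accepts Σs f n) where

  database-nullFree : NullFree (database f)
  database-nullFree = accepted 1 (s≤s z≤n)

  accepted⇒chase : InfiniteRChase Σs (database f)
  accepted⇒chase = record { F = chaseOf f ; start = λ _ → mk⇔ id id ; step = step ; fair = fair }
    where
    step : ∀ i → RChaseStep Σs (chaseOf f i) (chaseOf f (suc i))
    step i = Applicable⇒RChaseStep (proj₁ (accepted (2 + i) ≤-refl))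

    fair : ∀ i r σ → r ∈ Σs → Loaded r σ (chaseOf f i) →
           ∃ λ j → i ≤ j × Obsolete r σ (chaseOf f j)
    fair i r σ r∈Σs loaded =
      i ⊔ j , m≤m⊔n i j ,
      Obsolete-mono (accumulate-mono (m≤n⊔m i j)) (AllLoadedObsolete-lookup met r∈Σs loaded)
      where
      j : ℕ
      j = deadline (stepAt f i)
      met : AllLoadedObsolete Σs (chaseOf f i) (chaseOf f j)
      met = proj₂ (accepted (2 + i + j) (s≤s (s≤s (m≤m+n i j)))) (s≤s (m≤n+m j (suc i)))

module FromChase {Σs D} (chase : InfiniteRChase Σs D) where
  open InfiniteRChase chase

  ruleAt : ℕ → Rule
  ruleAt k = appliedRule (step k)

  substAt : ℕ → Subst
  substAt k = appliedSubst (step k)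

  -- The list that chaseOf rebuilds from the recorded steps; it has the same elements as F k.
  G : ℕ → FactSet
  G = accumulate D λ k → applyL (substAt k) (headAtoms (ruleAt k))

  G⊆F : ∀ k → G k ⊆ F k
  G⊆F zero    = from (start _)
  G⊆F (suc k) = from (output⇔ (step k) _) ∘ Sum.map₁ (G⊆F k) ∘ ∈-++⁻ (G k)

  F⊆G : ∀ k → F k ⊆ G k
  F⊆G zero    = to (start _)
  F⊆G (suc k) = [ ∈-++⁺ˡ ∘ F⊆G k , ∈-++⁺ʳ (G k) ]′ ∘ to (output⇔ (step k) _)

  -- Fairness bounds each enumerated trigger separately; as obsolescence persists while G grows,
  -- the maximum of these bounds serves for all of them.
  deadline-exists : ∀ k → ∃ λ j → AllLoadedObsolete Σs (G k) (G j)
  deadline-exists k =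
    uniform-bound
      (λ r j → All (ObsoleteBy j r ∘ assign (bodyVars r)) (assignments (bodyVars r) (termsOf (G k))))
      (λ i≤j → All.map (ObsoleteBy-mono i≤j))
      (All.tabulate λ {r} r∈Σs →
        uniform-bound (λ ts j → ObsoleteBy j r (assign (bodyVars r) ts)) ObsoleteBy-mono
          (All.tabulate λ _ → eventually-obsolete r∈Σs _))
    where
    ObsoleteBy : ℕ → Rule → Subst → Set
    ObsoleteBy j = LoadedObsolete (G k) (G j)

    ObsoleteBy-mono : ∀ {r σ i j} → i ≤ j → ObsoleteBy i r σ → ObsoleteBy j r σ
    ObsoleteBy-mono i≤j obsolete = Obsolete-mono (accumulate-mono i≤j) ∘ obsolete

    eventually-obsolete : ∀ {r} → r ∈ Σs → ∀ σ → ∃ λ j → ObsoleteBy j r σ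
    eventually-obsolete {r} r∈Σs σ with loaded? r σ (G k)
    ... | no ¬loaded = 0 , ⊥-elim ∘ ¬loaded
    ... | yes loaded with fair k r σ r∈Σs (G⊆F k ∘ loaded)
    ...   | j , _ , obsolete = j , λ _ → Obsolete-mono (F⊆G j) obsolete

  recordedStep : ℕ → Step
  recordedStep k =
    mkStep (ruleAt k) (map (substAt k) (ruleVars (ruleAt k))) (proj₁ (deadline-exists k))

  stream : ℕ → ℕ
  stream zero    = encode FactSet-coding D
  stream (suc k) = encode Step-coding (recordedStep k)

  stepAt-stream : ∀ k → stepAt stream k ≡ recordedStep k
  stepAt-stream k = decode-encode Step-coding (recordedStep k)

  chaseOf-stream : ∀ k → chaseOf stream k ≡ G k
  chaseOf-stream k = accumulate-cong k (decode-encode FactSet-coding D) λ {i} _ → begin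
    output (stepAt stream i)  ≡⟨ cong output (stepAt-stream i) ⟩
    output (recordedStep i)
      ≡⟨ applyL-cong (headAtoms (ruleAt i)) (assign-map _ ∘ ∈-++⁺ʳ (bodyVars (ruleAt i))) ⟩
    applyL (substAt i) (headAtoms (ruleAt i)) ∎
    where open ≡-Reasoning

  stepCheck : ∀ n k → StepCheck Σs n (G k) (recordedStep k) G
  stepCheck n k =
    Applicable-cong (sym ∘ assign-map _)
      (Applicable-resp (F⊆G k) (G⊆F k) (RChaseStep⇒Applicable (step k))) ,
    λ _ → proj₂ (deadline-exists k)

  stream-accepted : NullFree D → ∀ n → Accepts Σs stream n
  stream-accepted nullFree n {zero}  _ = subst NullFree (sym (decode-encode FactSet-coding D)) nullFree
  stream-accepted nullFree n {suc k} _ =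
    StepCheck-later (λ {j} _ → sym (chaseOf-stream j))
      (subst₂ (λ F s → StepCheck Σs n F s G) (sym (chaseOf-stream k)) (sym (stepAt-stream k))
        (stepCheck n k))

lemma5p2 : IsΠ¹₁ CTrest∀∀
lemma5p2 = Rejects , λ Σs → mk⇔
  (λ terminating f accepted →
     let accepts : ∀ n → Accepts Σs f n
         accepts n = to (Rejects-prefix Σs f n) (accepted n)
     in terminating (database f) (database-nullFree accepts) (accepted⇒chase accepts))
  (λ noAcceptedStream D nullFree chase →
     noAcceptedStream (FromChase.stream chase)
       (λ n → from (Rejects-prefix Σs _ n) (FromChase.stream-accepted chase nullFree n)))
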